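{- Let $\Gamma=(V,E)$ be a finite, undirected, weighted, connected graph with $N\ge 2$ vertices (loops allowed), and let $\overline{h}$ be its dual Cheeger constant. Then $\overline{h}\le 1$, and $\overline{h}=1$ if and only if $\Gamma$ is bipartite.
   Context: The weight function $w:V\times V\to\mathbb{R}$ satisfies $w_{ij}=w_{ji}$, $w_{ij}>0$ if $i\sim j$ (i.e. $i,j$ are joined by an edge; $i=j$ allowed, a loop) and $w_{ij}=0$ otherwise. The degree is $d_i=\sum_{j}w_{ij}$; $\mathrm{vol}(U)=\sum_{i\in U}d_i$ for $U\subseteq V$; $|E(U,W)|=\sum_{k\in U,\,l\in W}w_{kl}$ for $U,W\subseteq V$. The dual Cheeger constant is $$\overline{h}=\max_{V_1,V_2}\frac{2|E(V_1,V_2)|}{\mathrm{vol}(V_1)+\mathrm{vol}(V_2)},$$ the maximum being over all partitions of $V$ into disjoint sets $V_1,V_2,V_3$ with $V_1,V_2$ nonempty ($V_3=V\setminus(V_1\cup V_2)$ may be empty). A graph is bipartite if $V$ is a disjoint union of two classes such that no two vertices of the same class are joined by an edge (in particular there are no loops). -}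

module Defs where

open import Algebra.Apartness.Structures using (IsHeytingField)
open import Algebra.Bundles using (CommutativeRing; RawMonoid)
import Algebra.Definitions.RawMonoid as RawMonoidOps
import Algebra.Properties.Ring as RingProperties
open import Data.Bool.Base using (if_then_else_; true; false)
open import Data.Fin.Base using (Fin; zero; suc)
open import Data.Fin.Subset
  using (Subset; ⁅_⁆; ⊤; Nonempty; Empty; _∩_; _∪_; _∈_; inside; outside)
open import Data.Fin.Subset.Properties
  using (nonempty?; x∈⁅x⁆; x∈⁅y⁆⇒x≡y; x∈p∩q⁻)
open import Data.List.Base as List using (List; []; _∷_; _++_; foldr; concatMap)
import Data.List.Membership.Propositional as ListMem
open import Data.List.Membership.Propositional.Properties
  using (∈-++⁺ˡ; ∈-++⁺ʳ; ∈-map⁺)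
open import Data.List.Relation.Unary.Any using (here; there)
open import Data.Nat.Base as ℕ using (ℕ; s≤s; z≤n)
open import Data.Product.Base using (∃-syntax; _×_; _,_; proj₁; proj₂)
open import Data.Sum.Base using (_⊎_; inj₁; inj₂)
open import Data.Vec.Base using ([]; _∷_; lookup)
open import Data.Vec.Functional using (Vector)
open import Data.Vec.Properties using ([]=⇒lookup)
open import Level using (Level; 0ℓ) renaming (suc to lsuc; _⊔_ to _⊔ˡ_)
open import Relation.Binary.Construct.Closure.ReflexiveTransitive
  using (Star; ε; _◅_)
open import Relation.Binary.Core using (Rel)
open import Relation.Binary.Definitions using (Decidable; Symmetric)
open import Relation.Binary.Lattice.Definitions using (Supremum)
open import Relation.Binary.PropositionalEquality.Core as ≡ using (_≡_; _≢_)
open import Relation.Binary.Structures using (IsStrictPartialOrder)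
open import Relation.Nullary.Decidable.Core using (yes; no)
open import Relation.Nullary.Negation.Core using (¬_; contradiction)

-- The real numbers, axiomatised as a Cauchy complete Archimedean ordered
-- field.  The axioms are stated constructively, so that they hold both for the
-- classical reals and for Bishop's.  In particular x ≤ y is the negation of
-- y < x, apartness is x < y ⊎ y < x (whose cotransitivity, together with
-- transitivity of _<_, gives x < y → x < z ⊎ z < y), and binary maxima are
-- given by an operation because _<_ is not assumed to be decidable.
record Reals (c ℓ₁ ℓ₂ : Level) : Set (lsuc (c ⊔ˡ ℓ₁ ⊔ˡ ℓ₂)) where
  infix  8 -_
  infixl 7 _*_
  infixl 6 _+_ _⊔_
  infix  4 _≈_ _<_ _≤_ _#_

  field
    Carrier     : Set c
    _≈_         : Rel Carrier ℓ₁
    _<_         : Rel Carrier ℓ₂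
    _+_ _*_ _⊔_ : Carrier → Carrier → Carrier
    -_          : Carrier → Carrier
    0# 1#       : Carrier

  _≤_ : Rel Carrier ℓ₂
  x ≤ y = ¬ (y < x)

  _#_ : Rel Carrier ℓ₂
  x # y = x < y ⊎ y < x

  field
    isHeytingField       : IsHeytingField _≈_ _#_ _+_ _*_ -_ 0# 1#
    isStrictPartialOrder : IsStrictPartialOrder _≈_ _<_
    0<1                  : 0# < 1#
    +-monoˡ-<            : ∀ z {x y} → x < y → x + z < y + z
    *-pos                : ∀ {x y} → 0# < x → 0# < y → 0# < x * y
    ⊔-supremum           : Supremum _≤_ _⊔_

  open IsHeytingField isHeytingField public hiding (zero)
  module < = IsStrictPartialOrder isStrictPartialOrder

  commutativeRing : CommutativeRing c ℓ₁
  commutativeRing = record { isCommutativeRing = isCommutativeRing }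

  open CommutativeRing commutativeRing public using (ring; +-rawMonoid)

  open RawMonoidOps +-rawMonoid public using (sum) renaming (_×_ to _×ᴺ_)

  Cauchy : (ℕ → Carrier) → Set (c ⊔ˡ ℓ₂)
  Cauchy s = ∀ δ → 0# < δ → ∃[ k ] ∀ m n → k ℕ.≤ m → k ℕ.≤ n → s m - s n < δ

  Converges : (ℕ → Carrier) → Carrier → Set (c ⊔ˡ ℓ₂)
  Converges s x =
    ∀ δ → 0# < δ → ∃[ k ] ∀ m → k ℕ.≤ m → (s m - x < δ) × (x - s m < δ)

  field
    archimedean : ∀ x → ∃[ n ] x < n ×ᴺ 1#
    complete    : ∀ s → Cauchy s → ∃[ x ] Converges s x

  <-weaklyLinear : ∀ {x y} → x < y → ∀ z → x < z ⊎ z < y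
  <-weaklyLinear x<y z with #-cotrans (inj₁ x<y) z
  ... | inj₁ (inj₁ x<z) = inj₁ x<z
  ... | inj₁ (inj₂ z<x) = inj₂ (<.trans z<x x<y)
  ... | inj₂ (inj₁ z<y) = inj₂ z<y
  ... | inj₂ (inj₂ y<z) = inj₁ (<.trans x<y y<z)

  <⇒≤ : ∀ {x y} → x < y → x ≤ y
  <⇒≤ x<y y<x = <.irrefl refl (<.trans x<y y<x)

  ≤-trans : ∀ {x y z} → x ≤ y → y ≤ z → x ≤ z
  ≤-trans {y = y} x≤y y≤z z<x with <-weaklyLinear z<x y
  ... | inj₁ z<y = y≤z z<y
  ... | inj₂ y<x = x≤y y<x

  ≈⇒≤ : ∀ {x y} → x ≈ y → x ≤ y
  ≈⇒≤ x≈y y<x = <.irrefl (sym x≈y) y<x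

  0≤+0<⇒0< : ∀ {x y} → 0# ≤ x → 0# < y → 0# < x + y
  0≤+0<⇒0< {x} {y} 0≤x 0<y
    with <-weaklyLinear (<.<-respˡ-≈ (+-identityˡ x) (+-monoˡ-< x 0<y)) 0#
  ... | inj₁ x<0   = contradiction x<0 0≤x
  ... | inj₂ 0<y+x = <.<-respʳ-≈ (+-comm y x) 0<y+x

  0<+0≤⇒0< : ∀ {x y} → 0# < x → 0# ≤ y → 0# < x + y
  0<+0≤⇒0< {x} {y} 0<x 0≤y = <.<-respʳ-≈ (+-comm y x) (0≤+0<⇒0< 0≤y 0<x)

  0≤+0≤⇒0≤ : ∀ {x y} → 0# ≤ x → 0# ≤ y → 0# ≤ x + y
  0≤+0≤⇒0≤ {x} {y} 0≤x 0≤y x+y<0 with <-weaklyLinear x+y<0 y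
  ... | inj₂ y<0   = 0≤y y<0
  ... | inj₁ x+y<y = 0≤x (<.<-respˡ-≈ cancel (<.<-respʳ-≈ (-‿inverseʳ y)
                            (+-monoˡ-< (- y) x+y<y)))
    where
    cancel : (x + y) + - y ≈ x
    cancel = trans (+-assoc x y (- y))
                   (trans (+-congˡ (-‿inverseʳ y)) (+-identityʳ x))

  sum-nonneg : ∀ {n} (f : Vector Carrier n) → (∀ i → 0# ≤ f i) → 0# ≤ sum f
  sum-nonneg {ℕ.zero}  f f≥0 = <.irrefl refl
  sum-nonneg {ℕ.suc n} f f≥0 =
    0≤+0≤⇒0≤ (f≥0 zero) (sum-nonneg (λ i → f (suc i)) (λ i → f≥0 (suc i)))

  sum-pos : ∀ {n} (f : Vector Carrier n) → (∀ i → 0# ≤ f i) →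
            ∀ i → 0# < f i → 0# < sum f
  sum-pos f f≥0 zero    fi>0 =
    0<+0≤⇒0< fi>0 (sum-nonneg (λ i → f (suc i)) (λ i → f≥0 (suc i)))
  sum-pos f f≥0 (suc i) fi>0 =
    0≤+0<⇒0< (f≥0 zero) (sum-pos (λ i → f (suc i)) (λ i → f≥0 (suc i)) i fi>0)

  -‿identityʳ : ∀ x → x - 0# ≈ x
  -‿identityʳ x =
    trans (+-congˡ (RingProperties.-0#≈0# ring)) (+-identityʳ x)

  recip : ∀ x → 0# < x → Carrier
  recip x 0<x = proj₁ (#⇒invertible (inj₂ 0<x))

  recip-inverseʳ : ∀ x (0<x : 0# < x) → x * recip x 0<x ≈ 1#
  recip-inverseʳ x 0<x =
    trans (*-congʳ (sym (-‿identityʳ x))) (proj₂ (proj₂ (#⇒invertible (inj₂ 0<x))))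

  recip-unique : ∀ x (p q : 0# < x) → recip x p ≈ recip x q
  recip-unique x p q =
    trans (sym (*-identityʳ _))
    (trans (*-congˡ (sym (recip-inverseʳ x q)))
    (trans (sym (*-assoc _ x _))
    (trans (*-congʳ (trans (*-comm _ x) (recip-inverseʳ x p)))
           (*-identityˡ _))))

  infixl 7 _/⟨_⟩

  -- x /⟨ p ⟩ is the quotient x / y, where p proves 0 < y.
  _/⟨_⟩ : ∀ {y} → Carrier → 0# < y → Carrier
  _/⟨_⟩ {y} x 0<y = x * recip y 0<y

-- Disjoint nonempty V₁, V₂; the third part V₃ is the complement of V₁ ∪ V₂.
record Partition (n : ℕ) : Set where
  field
    V₁ V₂     : Subset n
    disjoint  : Empty (V₁ ∩ V₂)
    nonempty₁ : Nonempty V₁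
    nonempty₂ : Nonempty V₂

open Partition

subsets : ∀ n → List (Subset n)
subsets ℕ.zero    = [] ∷ []
subsets (ℕ.suc n) =
  List.map (inside ∷_) (subsets n) ++ List.map (outside ∷_) (subsets n)

partitionsOn : ∀ {n} → Subset n → Subset n → List (Partition n)
partitionsOn A B with nonempty? (A ∩ B) | nonempty? A | nonempty? B
... | no A∩B=∅ | yes A≠∅ | yes B≠∅ = record
  { V₁ = A ; V₂ = B ; disjoint = A∩B=∅ ; nonempty₁ = A≠∅ ; nonempty₂ = B≠∅ } ∷ []
... | _        | _       | _       = []

partitions : ∀ n → List (Partition n)
partitions n =
  concatMap (λ A → concatMap (λ B → partitionsOn A B) (subsets n)) (subsets n)

-- A partition exists because n ≥ 2.
somePartition : ∀ {n} → 2 ℕ.≤ n → Partition n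
somePartition {ℕ.suc (ℕ.suc n)} (s≤s (s≤s z≤n)) = record
  { V₁        = ⁅ zero ⁆
  ; V₂        = ⁅ suc zero ⁆
  ; disjoint  = λ { (x , x∈) → zero≢one
      (≡.trans (≡.sym (x∈⁅y⁆⇒x≡y zero (proj₁ (x∈p∩q⁻ ⁅ zero ⁆ ⁅ suc zero ⁆ x∈))))
               (x∈⁅y⁆⇒x≡y (suc zero) (proj₂ (x∈p∩q⁻ ⁅ zero ⁆ ⁅ suc zero ⁆ x∈)))) }
  ; nonempty₁ = zero , x∈⁅x⁆ zero
  ; nonempty₂ = suc zero , x∈⁅x⁆ (suc zero)
  }
  where
  zero≢one : _≢_ {A = Fin (ℕ.suc (ℕ.suc n))} zero (suc zero)
  zero≢one ()

module _ where
  open ListMem using () renaming (_∈_ to _∈ᴸ_)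

  ∈-concatMap : ∀ {a b} {A : Set a} {B : Set b} (f : A → List B) {x y xs} →
                x ∈ᴸ xs → y ∈ᴸ f x → y ∈ᴸ concatMap f xs
  ∈-concatMap f (here ≡.refl)            y∈ = ∈-++⁺ˡ y∈
  ∈-concatMap f {xs = x ∷ _} (there x∈) y∈ = ∈-++⁺ʳ (f x) (∈-concatMap f x∈ y∈)

  ∈-subsets : ∀ {n} (A : Subset n) → A ∈ᴸ subsets n
  ∈-subsets []            = here ≡.refl
  ∈-subsets (true  ∷ A)   = ∈-++⁺ˡ (∈-map⁺ _ (∈-subsets A))
  ∈-subsets (false ∷ A)   = ∈-++⁺ʳ _ (∈-map⁺ _ (∈-subsets A))

  ∈-partitionsOn : ∀ {n} (P : Partition n) →
    ∃[ Q ] (Q ∈ᴸ partitionsOn (V₁ P) (V₂ P)) × (V₁ Q ≡ V₁ P) × (V₂ Q ≡ V₂ P)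
  ∈-partitionsOn P
    with nonempty? (V₁ P ∩ V₂ P) | nonempty? (V₁ P) | nonempty? (V₂ P)
  ... | no  _ | yes _ | yes _ = _ , here ≡.refl , ≡.refl , ≡.refl
  ... | yes p | _     | _     = contradiction p (disjoint P)
  ... | no  _ | no ¬p | _     = contradiction (nonempty₁ P) ¬p
  ... | no  _ | yes _ | no ¬p = contradiction (nonempty₂ P) ¬p

  ∈-partitions : ∀ {n} (P : Partition n) →
    ∃[ Q ] (Q ∈ᴸ partitions n) × (V₁ Q ≡ V₁ P) × (V₂ Q ≡ V₂ P)
  ∈-partitions {n} P with ∈-partitionsOn P
  ... | Q , Q∈ , eqs =
    Q , ∈-concatMap _ (∈-subsets (V₁ P)) (∈-concatMap _ (∈-subsets (V₂ P)) Q∈) , eqs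

module _ {c ℓ₁ ℓ₂} (ℝ : Reals c ℓ₁ ℓ₂) where
  open Reals ℝ

  -- Loops (i ∼ i) are allowed; adjacency is decidable since the graph is finite.
  record WeightedGraph (n : ℕ) : Set (lsuc 0ℓ ⊔ˡ c ⊔ˡ ℓ₁ ⊔ˡ ℓ₂) where
    infix 4 _∼_ _∼?_
    field
      _∼_    : Rel (Fin n) 0ℓ
      _∼?_   : Decidable _∼_
      ∼-sym  : Symmetric _∼_
      w      : Fin n → Fin n → Carrier
      w-sym  : ∀ i j → w i j ≈ w j i
      w-pos  : ∀ {i j} → i ∼ j → 0# < w i j
      w-zero : ∀ {i j} → ¬ (i ∼ j) → w i j ≈ 0#

module _ {c ℓ₁ ℓ₂} {ℝ : Reals c ℓ₁ ℓ₂} {n : ℕ} (Γ : WeightedGraph ℝ n) where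
  open Reals ℝ
  open WeightedGraph Γ

  Connected : Set
  Connected = ∀ i j → Star _∼_ i j

  Bipartite : Set
  Bipartite = ∃[ A ] ∃[ B ] Empty (A ∩ B) × (A ∪ B ≡ ⊤)
    × (∀ {i j} → i ∈ A → j ∈ A → ¬ (i ∼ j))
    × (∀ {i j} → i ∈ B → j ∈ B → ¬ (i ∼ j))

  degree : Fin n → Carrier
  degree i = sum λ j → w i j

  sumOver : Subset n → (Fin n → Carrier) → Carrier
  sumOver U f = sum λ i → if lookup U i then f i else 0#

  vol : Subset n → Carrier
  vol U = sumOver U degree

  ∣E⟨_,_⟩∣ : Subset n → Subset n → Carrier
  ∣E⟨ U , W ⟩∣ = sumOver U λ k → sumOver W λ l → w k l

  w-nonneg : ∀ i j → 0# ≤ w i j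
  w-nonneg i j with i ∼? j
  ... | yes i∼j = <⇒≤ (w-pos i∼j)
  ... | no  i≁j = ≈⇒≤ (sym (w-zero i≁j))

  neighbour : 2 ℕ.≤ n → Connected → ∀ i → ∃[ j ] i ∼ j
  neighbour 2≤n conn i with other 2≤n i
    where
    other : ∀ {m} → 2 ℕ.≤ m → (i : Fin m) → ∃[ j ] i ≢ j
    other (s≤s (s≤s z≤n)) zero    = suc zero , λ ()
    other (s≤s (s≤s z≤n)) (suc i) = zero , λ ()
  ... | j , i≢j with conn i j
  ...   | ε       = contradiction ≡.refl i≢j
  ...   | i∼k ◅ _ = _ , i∼k

  degree-pos : 2 ℕ.≤ n → Connected → ∀ i → 0# < degree i
  degree-pos 2≤n conn i with neighbour 2≤n conn i
  ... | j , i∼j = sum-pos (w i) (w-nonneg i) j (w-pos i∼j)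

  vol-pos : 2 ℕ.≤ n → Connected → ∀ U → Nonempty U → 0# < vol U
  vol-pos 2≤n conn U (i , i∈U) = sum-pos _ nonneg i pos
    where
    nonneg : ∀ j → 0# ≤ (if lookup U j then degree j else 0#)
    nonneg j with lookup U j
    ... | true  = <⇒≤ (degree-pos 2≤n conn j)
    ... | false = <.irrefl refl
    pos : 0# < (if lookup U i then degree i else 0#)
    pos rewrite []=⇒lookup i∈U = degree-pos 2≤n conn i

  module _ (2≤n : 2 ℕ.≤ n) (conn : Connected) where

    vol₁+vol₂-pos : ∀ P → 0# < vol (V₁ P) + vol (V₂ P)
    vol₁+vol₂-pos P =
      0<+0≤⇒0< (vol-pos 2≤n conn (V₁ P) (nonempty₁ P))
               (<⇒≤ (vol-pos 2≤n conn (V₂ P) (nonempty₂ P)))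

    cheegerRatio : Partition n → Carrier
    cheegerRatio P = ((1# + 1#) * ∣E⟨ V₁ P , V₂ P ⟩∣) /⟨ vol₁+vol₂-pos P ⟩

    -- The maximum over all partitions; the seed of the fold is itself one of
    -- the ratios, so it does not affect the value.
    dualCheeger : Carrier
    dualCheeger =
      foldr _⊔_ (cheegerRatio (somePartition 2≤n))
            (List.map cheegerRatio (partitions n))

    cheegerRatio-cong : ∀ P Q → V₁ P ≡ V₁ Q → V₂ P ≡ V₂ Q →
                        cheegerRatio P ≈ cheegerRatio Q
    cheegerRatio-cong P Q e₁ e₂ =
      go (V₁ P) (V₁ Q) (V₂ P) (V₂ Q) e₁ e₂ (vol₁+vol₂-pos P) (vol₁+vol₂-pos Q)
      where
      go : ∀ A A′ B B′ → A ≡ A′ → B ≡ B′ →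
           (p : 0# < vol A + vol B) (q : 0# < vol A′ + vol B′) →
           ((1# + 1#) * ∣E⟨ A , B ⟩∣) /⟨ p ⟩ ≈ ((1# + 1#) * ∣E⟨ A′ , B′ ⟩∣) /⟨ q ⟩
      go A _ B _ ≡.refl ≡.refl p q = *-congˡ (recip-unique _ p q)

    -- Together the next two lemmas say that dualCheeger is the supremum of the
    -- ratios over all partitions.
    dualCheeger-upper : ∀ P → cheegerRatio P ≤ dualCheeger
    dualCheeger-upper P with ∈-partitions P
    ... | Q , Q∈ , e₁ , e₂ =
      ≤-trans (≈⇒≤ (sym (cheegerRatio-cong Q P e₁ e₂))) (go (partitions n) Q∈)
      where
      go : ∀ Ps → Q ListMem.∈ Ps →
           cheegerRatio Q ≤ foldr _⊔_ (cheegerRatio (somePartition 2≤n))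
                                      (List.map cheegerRatio Ps)
      go (R ∷ Ps) (here ≡.refl) = proj₁ (⊔-supremum _ _)
      go (R ∷ Ps) (there Q∈Ps)  =
        ≤-trans (go Ps Q∈Ps) (proj₁ (proj₂ (⊔-supremum _ _)))

    dualCheeger-least : ∀ z → (∀ P → cheegerRatio P ≤ z) → dualCheeger ≤ z
    dualCheeger-least z bound = go (partitions n)
      where
      go : ∀ Ps → foldr _⊔_ (cheegerRatio (somePartition 2≤n))
                            (List.map cheegerRatio Ps) ≤ z
      go []       = bound (somePartition 2≤n)
      go (R ∷ Ps) = proj₂ (proj₂ (⊔-supremum _ _)) z (bound R) (go Ps)

{-# OPTIONS --safe #-}

-- Splitting each degree according to whether the second endpoint lies in a
-- given set gives, for all U and W,
--   vol U + vol W = 2 |E(U,W)| + (|E(U,∁W)| + |E(W,∁U)|),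
-- so a ratio is at most 1, with equality exactly when the bracketed deficit
-- vanishes.  As weights are nonnegative, this means that every edge from U ends
-- in W and vice versa; by connectedness U and W then exhaust the vertices and
-- are the classes of a bipartition.  Conversely the classes of a bipartition
-- have deficit 0.  Which partition attains the maximum cannot be decided in ℝ,
-- but bipartiteness is decidable, so it suffices to refute its negation.
module Submission where

open import Data.Nat.Base as ℕ using (ℕ)
open import Data.Product.Base using (_×_)
open import Function.Bundles using (_⇔_)
open import Level using (Level)
open import Defs

open import Algebra.Bundles using (CommutativeRing)
import Algebra.Properties.AbelianGroup as AbelianGroupProperties
import Algebra.Properties.CommutativeMonoid.Sum as SumProperties
import Algebra.Properties.CommutativeSemigroup as CommutativeSemigroupProperties
import Algebra.Properties.Group as GroupProperties
import Algebra.Properties.Ring as RingProperties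
open import Data.Bool.Base using (true; false; not; if_then_else_)
import Data.Bool.Properties as Bool
open import Data.Fin.Base using (Fin)
import Data.Fin.Properties as Fin
open import Data.Fin.Subset
  using (Subset; _∈_; _∩_; _∪_; ∁; ⊤; Nonempty)
open import Data.Fin.Subset.Properties
  using (_∈?_; nonempty?; anySubset?; ⊆⊤; ⊆-antisym; ∈⊤; x∈p∩q⁺;
         x∈p∪q⁺; x∈p∪q⁻; x∈∁p⇒x∉p; x∉p⇒x∈∁p)
open import Data.List.Base as List using ([]; _∷_; foldr)
open import Data.Product.Base using (∃-syntax; _,_; proj₁; proj₂)
open import Data.Sum.Base using (_⊎_; inj₁; inj₂; [_,_]; swap)
open import Data.Vec.Base using (lookup)
open import Data.Vec.Properties
  using (≡-dec; lookup-map; []=⇒lookup; lookup⇒[]=)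
open import Function.Base using (_∘_)
open import Function.Bundles using (mk⇔)
open import Relation.Binary.Construct.Closure.ReflexiveTransitive
  using (Star; ε; _◅_)
open import Relation.Binary.PropositionalEquality.Core as ≡ using (_≡_)
import Relation.Binary.Reasoning.Setoid as SetoidReasoning
open import Relation.Nullary.Decidable.Core
  using (Dec; map′; ¬?; _×-dec_; _→-dec_; decidable-stable)
open import Relation.Nullary.Negation.Core using (¬_; contradiction)

open Partition

-- Order and maxima in the constructive reals.

module RealProperties {c ℓ₁ ℓ₂} (ℝ : Reals c ℓ₁ ℓ₂) where
  open Reals ℝ
  open CommutativeRing commutativeRing using (+-abelianGroup; +-group)
  open SetoidReasoning setoid

  -- Apartness is tight, and the two hypotheses refute the two halves of `x # y`.
  ≤-antisym : ∀ {x y} → x ≤ y → y ≤ x → x ≈ y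
  ≤-antisym x≤y y≤x = proj₁ (tight _ _) [ y≤x , x≤y ]

  *-monoʳ-< : ∀ {x y z} → 0# < z → x < y → z * x < z * y
  *-monoʳ-< {x} {y} {z} 0<z x<y =
    <.<-respʳ-≈ (//-rightDividesˡ (z * x) (z * y))
      (<.<-respˡ-≈ (+-identityˡ (z * x))
        (+-monoˡ-< (z * x) (<.<-respʳ-≈ (x[y-z]≈xy-xz z y x) (*-pos 0<z 0<y-x))))
    where
    open GroupProperties +-group using (//-rightDividesˡ)
    open RingProperties ring using (x[y-z]≈xy-xz)
    0<y-x : 0# < y - x
    0<y-x = <.<-respˡ-≈ (-‿inverseʳ x) (+-monoˡ-< (- x) x<y)

  -- With `_<_` undecidable, no disjunction can be extracted from `z ≤ x ⊔ y`, so the fact is stated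
  -- negatively. If `y < x`, then `x ⊔ y ≤ x` and hence `z ≤ x`, which is excluded; so `x ≤ y`, and
  -- then `x ⊔ y ≤ y` forces `z ≤ y`.
  ⊔-¬≤ : ∀ {x y z} → ¬ (z ≤ x) → ¬ (z ≤ y) → ¬ (z ≤ x ⊔ y)
  ⊔-¬≤ {x} {y} z≰x z≰y z≤x⊔y =
    z≰y (≤-trans z≤x⊔y (proj₂ (proj₂ (⊔-supremum x y)) y x≤y (<.irrefl refl)))
    where
    x≤y : x ≤ y
    x≤y y<x = z≰x (≤-trans z≤x⊔y
      (proj₂ (proj₂ (⊔-supremum x y)) x (<.irrefl refl) (<⇒≤ y<x)))

  foldr-⊔-¬≤ : ∀ {a} {A : Set a} {z s} (f : A → Carrier) →
               ¬ (z ≤ s) → (∀ x → ¬ (z ≤ f x)) →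
               ∀ xs → ¬ (z ≤ foldr _⊔_ s (List.map f xs))
  foldr-⊔-¬≤ f z≰s z≰f []       = z≰s
  foldr-⊔-¬≤ f z≰s z≰f (x ∷ xs) = ⊔-¬≤ (z≰f x) (foldr-⊔-¬≤ f z≰s z≰f xs)

  -- Comparing a quotient with 1 through the gap between its denominator and numerator.

  module _ {x y d} (0<y : 0# < y) (y≈x+d : y ≈ x + d) where
    open AbelianGroupProperties +-abelianGroup using (xyx⁻¹≈y)

    *-/-cancel : y * (x /⟨ 0<y ⟩) ≈ x
    *-/-cancel = begin
      y * (x * recip y 0<y)  ≈⟨ *-comm y _ ⟩
      x * recip y 0<y * y    ≈⟨ *-assoc x _ y ⟩
      x * (recip y 0<y * y)  ≈⟨ *-congˡ (*-comm _ y) ⟩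
      x * (y * recip y 0<y)  ≈⟨ *-congˡ (recip-inverseʳ y 0<y) ⟩
      x * 1#                 ≈⟨ *-identityʳ x ⟩
      x                      ∎

    -- Multiplying `1 < x / y` by `y` gives `x + d < x`, hence `d < 0`.
    /-≤1 : 0# ≤ d → x /⟨ 0<y ⟩ ≤ 1#
    /-≤1 0≤d 1<x/y =
      0≤d (<.<-respʳ-≈ (-‿inverseʳ x) (<.<-respˡ-≈ (xyx⁻¹≈y x d)
        (+-monoˡ-< (- x) x+d<x)))
      where
      x+d<x : x + d < x
      x+d<x = <.<-respˡ-≈ (trans (*-identityʳ y) y≈x+d)
        (<.<-respʳ-≈ *-/-cancel (*-monoʳ-< 0<y 1<x/y))

    /-≈1⇒≈0 : x /⟨ 0<y ⟩ ≈ 1# → d ≈ 0#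
    /-≈1⇒≈0 x/y≈1 = begin
      d                         ≈⟨ xyx⁻¹≈y x d ⟨
      x + d - x                 ≈⟨ +-congʳ y≈x+d ⟨
      y - x                     ≈⟨ +-congʳ (*-identityʳ y) ⟨
      y * 1# - x                ≈⟨ +-congʳ (*-congˡ x/y≈1) ⟨
      y * (x /⟨ 0<y ⟩) - x      ≈⟨ +-congʳ *-/-cancel ⟩
      x - x                     ≈⟨ -‿inverseʳ x ⟩
      0#                        ∎

    ≈0⇒/-≈1 : d ≈ 0# → x /⟨ 0<y ⟩ ≈ 1#
    ≈0⇒/-≈1 d≈0 = begin
      x * recip y 0<y           ≈⟨ *-congʳ (+-identityʳ x) ⟨
      (x + 0#) * recip y 0<y    ≈⟨ *-congʳ (+-congˡ d≈0) ⟨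
      (x + d) * recip y 0<y     ≈⟨ *-congʳ y≈x+d ⟨
      y * recip y 0<y           ≈⟨ recip-inverseʳ y 0<y ⟩
      1#                        ∎

module GraphProperties
  {c ℓ₁ ℓ₂} (ℝ : Reals c ℓ₁ ℓ₂) {n : ℕ} (Γ : WeightedGraph ℝ n) where
  open Reals ℝ
  open RealProperties ℝ
  open WeightedGraph Γ
  open CommutativeRing commutativeRing
    using (+-commutativeMonoid; +-commutativeSemigroup)
  open CommutativeSemigroupProperties +-commutativeSemigroup using (interchange)
  open SetoidReasoning setoid
  open SumProperties +-commutativeMonoid
    using (sum-cong-≋; sum-replicate-zero; ∑-distrib-+; ∑-comm)

  private
    ∑ : Subset n → (Fin n → Carrier) → Carrier
    ∑ = sumOver Γ

    E : Subset n → Subset n → Carrier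
    E = ∣E⟨_,_⟩∣ Γ

  -- Sums over subsets.

  sumOver-cong : ∀ U {f g} → (∀ {i} → i ∈ U → f i ≈ g i) → ∑ U f ≈ ∑ U g
  sumOver-cong U {f} {g} f≈g = sum-cong-≋ term
    where
    term : ∀ i → (if lookup U i then f i else 0#) ≈
                 (if lookup U i then g i else 0#)
    term i with lookup U i in eq
    ... | true  = f≈g (lookup⇒[]= i U eq)
    ... | false = refl

  sumOver-zero : ∀ U {f} → (∀ {i} → i ∈ U → f i ≈ 0#) → ∑ U f ≈ 0#
  sumOver-zero U {f} f≈0 = trans (sum-cong-≋ term) (sum-replicate-zero n)
    where
    term : ∀ i → (if lookup U i then f i else 0#) ≈ 0#
    term i with lookup U i in eq
    ... | true  = f≈0 (lookup⇒[]= i U eq)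
    ... | false = refl

  sumOver-+ : ∀ U f g → ∑ U (λ i → f i + g i) ≈ ∑ U f + ∑ U g
  sumOver-+ U f g = trans (sum-cong-≋ term) (∑-distrib-+ {n} _ _)
    where
    term : ∀ i → (if lookup U i then f i + g i else 0#) ≈
      (if lookup U i then f i else 0#) + (if lookup U i then g i else 0#)
    term i with lookup U i
    ... | true  = refl
    ... | false = sym (+-identityʳ 0#)

  sumOver-∁ : ∀ U f → sum f ≈ ∑ U f + ∑ (∁ U) f
  sumOver-∁ U f = trans (sum-cong-≋ term) (∑-distrib-+ {n} _ _)
    where
    term : ∀ i → f i ≈
      (if lookup U i then f i else 0#) + (if lookup (∁ U) i then f i else 0#)
    -- Membership in `∁ U` becomes the negation of the Boolean for `U`, so one case split settles
    -- both summands.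
    term i rewrite lookup-map i not U with lookup U i
    ... | true  = sym (+-identityʳ (f i))
    ... | false = sym (+-identityˡ (f i))

  -- Pushing the indicator of `U` inside the inner sum gives a double sum over all vertices, where
  -- the finite Fubini rule `∑-comm` applies.
  sumOver-comm : ∀ U W (f : Fin n → Fin n → Carrier) →
    ∑ U (λ k → ∑ W (f k)) ≈ ∑ W (λ l → ∑ U (λ k → f k l))
  sumOver-comm U W f = begin
    ∑ U (λ k → ∑ W (f k))
      ≈⟨ sum-cong-≋ (λ k → if-sum (lookup U k) _) ⟩
    (sum λ k → sum λ l →
      if lookup U k then (if lookup W l then f k l else 0#) else 0#)
      ≈⟨ ∑-comm {n} {n} _ ⟩
    (sum λ l → sum λ k →
      if lookup U k then (if lookup W l then f k l else 0#) else 0#)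
      ≈⟨ sum-cong-≋ (λ l → sum-cong-≋ λ k →
           if-comm (lookup U k) (lookup W l) (f k l)) ⟩
    (sum λ l → sum λ k →
      if lookup W l then (if lookup U k then f k l else 0#) else 0#)
      ≈⟨ sum-cong-≋ (λ l → if-sum (lookup W l) _) ⟨
    ∑ W (λ l → ∑ U (λ k → f k l))  ∎
    where
    if-sum : ∀ b (g : Fin n → Carrier) →
      (if b then sum g else 0#) ≈ sum (λ i → if b then g i else 0#)
    if-sum true  g = refl
    if-sum false g = sym (sum-replicate-zero n)

    if-comm : ∀ b b′ x → (if b then (if b′ then x else 0#) else 0#) ≈
                         (if b′ then (if b then x else 0#) else 0#)
    if-comm true  b′    x = refl
    if-comm false true  x = refl
    if-comm false false x = refl

  private
    if-nonneg : ∀ (U : Subset n) {f : Fin n → Carrier} →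
                (∀ i → 0# ≤ f i) →
                ∀ i → 0# ≤ (if lookup U i then f i else 0#)
    if-nonneg U 0≤f i with lookup U i
    ... | true  = 0≤f i
    ... | false = <.irrefl refl

  sumOver-nonneg : ∀ U {f} → (∀ i → 0# ≤ f i) → 0# ≤ ∑ U f
  sumOver-nonneg U 0≤f = sum-nonneg _ (if-nonneg U 0≤f)

  sumOver-pos : ∀ U {f i} → (∀ i → 0# ≤ f i) → i ∈ U → 0# < f i → 0# < ∑ U f
  sumOver-pos U {f} {i} 0≤f i∈U 0<fi = sum-pos _ (if-nonneg U 0≤f) i pos
    where
    pos : 0# < (if lookup U i then f i else 0#)
    pos rewrite []=⇒lookup i∈U = 0<fi

  -- Edge weights and the splitting of volumes.

  E-nonneg : ∀ U W → 0# ≤ E U W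
  E-nonneg U W = sumOver-nonneg U λ k → sumOver-nonneg W (w-nonneg Γ k)

  E-pos : ∀ U W {i j} → i ∈ U → j ∈ W → i ∼ j → 0# < E U W
  E-pos U W {i} i∈U j∈W i∼j =
    sumOver-pos U (λ k → sumOver-nonneg W (w-nonneg Γ k)) i∈U
      (sumOver-pos W (w-nonneg Γ i) j∈W (w-pos i∼j))

  E-zero : ∀ U W → (∀ {i j} → i ∈ U → j ∈ W → ¬ (i ∼ j)) → E U W ≈ 0#
  E-zero U W U≁W =
    sumOver-zero U λ i∈U → sumOver-zero W λ j∈W → w-zero (U≁W i∈U j∈W)

  E-sym : ∀ U W → E U W ≈ E W U
  E-sym U W = trans (sumOver-comm U W w)
    (sumOver-cong W λ _ → sumOver-cong U λ _ → w-sym _ _)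

  vol-split : ∀ U W → vol Γ U ≈ E U W + E U (∁ W)
  vol-split U W =
    trans (sumOver-cong U λ _ → sumOver-∁ W _) (sumOver-+ U _ _)

  -- For disjoint `U` and `W` the set `∁ W` contains `U`, so edges inside `U` are counted here as
  -- well as edges leaving `U ∪ W`; likewise for `W`.
  deficit : Subset n → Subset n → Carrier
  deficit U W = E U (∁ W) + E W (∁ U)

  vol+vol≈2E+deficit : ∀ U W →
    vol Γ U + vol Γ W ≈ (1# + 1#) * E U W + deficit U W
  vol+vol≈2E+deficit U W = begin
    vol Γ U + vol Γ W
      ≈⟨ +-cong (vol-split U W) (vol-split W U) ⟩
    (E U W + E U (∁ W)) + (E W U + E W (∁ U))
      ≈⟨ interchange _ _ _ _ ⟩
    (E U W + E W U) + deficit U W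
      ≈⟨ +-congʳ (+-congˡ (E-sym W U)) ⟩
    (E U W + E U W) + deficit U W
      ≈⟨ +-congʳ (+-cong (*-identityˡ _) (*-identityˡ _)) ⟨
    (1# * E U W + 1# * E U W) + deficit U W
      ≈⟨ +-congʳ (distribʳ (E U W) 1# 1#) ⟨
    (1# + 1#) * E U W + deficit U W  ∎

  deficit-nonneg : ∀ U W → 0# ≤ deficit U W
  deficit-nonneg U W = 0≤+0≤⇒0≤ (E-nonneg U (∁ W)) (E-nonneg W (∁ U))

  deficit-comm : ∀ U W → deficit U W ≈ deficit W U
  deficit-comm U W = +-comm _ _

  -- Vanishing deficit yields a bipartition.

  deficit≈0⇒crossing : ∀ U W → deficit U W ≈ 0# →
                       ∀ {i j} → i ∈ U → i ∼ j → j ∈ W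
  deficit≈0⇒crossing U W d≈0 {j = j} i∈U i∼j =
    -- An edge from `U` missing `W` would make the deficit positive; membership is decidable, so
    -- refuting `j ∉ W` suffices.
    decidable-stable (j ∈? W) λ j∉W → <.irrefl (sym d≈0)
      (0<+0≤⇒0< (E-pos U (∁ W) i∈U (x∉p⇒x∈∁p j∉W) i∼j) (E-nonneg W (∁ U)))

  -- Each edge of a walk switches sides, so the walk never leaves the union.
  deficit≈0⇒∪-closed : ∀ U W → deficit U W ≈ 0# →
                       ∀ {i j} → Star _∼_ i j → i ∈ U ⊎ i ∈ W → j ∈ U ⊎ j ∈ W
  deficit≈0⇒∪-closed U W d≈0 ε            i∈ = i∈
  deficit≈0⇒∪-closed U W d≈0 (i∼k ◅ k∼*j) i∈ =
    deficit≈0⇒∪-closed U W d≈0 k∼*j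
      ([ (λ i∈U → inj₂ (deficit≈0⇒crossing U W d≈0 i∈U i∼k))
       , (λ i∈W → inj₁ (deficit≈0⇒crossing W U d′≈0 i∈W i∼k)) ] i∈)
    where d′≈0 = trans (deficit-comm W U) d≈0

  -- Walks from a vertex of `V₁ P` reach every vertex, so the two sets cover the graph. An edge
  -- within one class would have its end in both classes, against disjointness.
  deficit≈0⇒bipartite : Connected Γ → ∀ P → deficit (V₁ P) (V₂ P) ≈ 0# →
                        Bipartite Γ
  deficit≈0⇒bipartite conn P d≈0 =
    V₁ P , V₂ P , disjoint P , ⊆-antisym ⊆⊤ (λ {j} _ → x∈p∪q⁺ (covers j)) ,
    (λ i∈V₁ j∈V₁ i∼j → disjoint P (_ , x∈p∩q⁺
      (j∈V₁ , deficit≈0⇒crossing _ _ d≈0 i∈V₁ i∼j))) ,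
    (λ i∈V₂ j∈V₂ i∼j → disjoint P (_ , x∈p∩q⁺
      (deficit≈0⇒crossing _ _ d′≈0 i∈V₂ i∼j , j∈V₂)))
    where
    d′≈0 : deficit (V₂ P) (V₁ P) ≈ 0#
    d′≈0 = trans (deficit-comm (V₂ P) (V₁ P)) d≈0
    covers : ∀ j → j ∈ V₁ P ⊎ j ∈ V₂ P
    covers j with nonempty₁ P
    ... | i , i∈V₁ = deficit≈0⇒∪-closed _ _ d≈0 (conn i j) (inj₁ i∈V₁)

  -- Decidability of bipartiteness.

  Independent : Subset n → Set
  Independent U = ∀ {i j} → i ∈ U → j ∈ U → ¬ (i ∼ j)

  Independent? : ∀ U → Dec (Independent U)
  Independent? U = map′ (λ h {i} {j} → h i j) (λ h i j → h)
    (Fin.all? λ i → Fin.all? λ j → i ∈? U →-dec j ∈? U →-dec ¬? (i ∼? j))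

  -- A finite search over pairs of subsets; it makes proof by contradiction available for
  -- bipartiteness.
  Bipartite? : Dec (Bipartite Γ)
  Bipartite? = anySubset? λ A → anySubset? λ B →
    ¬? (nonempty? (A ∩ B)) ×-dec ≡-dec Bool._≟_ (A ∪ B) ⊤
      ×-dec Independent? A ×-dec Independent? B

  -- A bipartition has vanishing deficit.

  module _ {A B : Subset n} (A∪B≡⊤ : A ∪ B ≡ ⊤) where

    covered : ∀ i → i ∈ A ⊎ i ∈ B
    covered i = x∈p∪q⁻ A B (≡.subst (i ∈_) (≡.sym A∪B≡⊤) ∈⊤)

    E-∁-zero : Independent A → E A (∁ B) ≈ 0#
    -- A vertex outside `B` lies in `A`, so such an edge would join two vertices of `A`.
    E-∁-zero indep = E-zero A (∁ B) λ {_} {j} i∈A j∈∁B →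
      [ indep i∈A , (λ j∈B → contradiction j∈B (x∈∁p⇒x∉p j∈∁B)) ] (covered j)

  -- The given edge has its ends in different classes, which shows that both are nonempty.
  bipartite⇒partition : (∃[ i ] ∃[ j ] i ∼ j) → Bipartite Γ →
                        ∃[ P ] deficit (V₁ P) (V₂ P) ≈ 0#
  bipartite⇒partition (i , j , i∼j) (A , B , disj , A∪B≡⊤ , indA , indB) =
    record { V₁ = A ; V₂ = B ; disjoint = disj
           ; nonempty₁ = proj₁ nonempty ; nonempty₂ = proj₂ nonempty } ,
    trans (+-cong (E-∁-zero A∪B≡⊤ indA) (E-∁-zero B∪A≡⊤ indB)) (+-identityʳ 0#)
    where
    B∪A≡⊤ : B ∪ A ≡ ⊤
    B∪A≡⊤ = ⊆-antisym ⊆⊤ λ {k} _ → x∈p∪q⁺ (swap (covered A∪B≡⊤ k))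
    nonempty : Nonempty A × Nonempty B
    nonempty with covered A∪B≡⊤ i | covered A∪B≡⊤ j
    ... | inj₁ i∈A | inj₁ j∈A = contradiction i∼j (indA i∈A j∈A)
    ... | inj₁ i∈A | inj₂ j∈B = (i , i∈A) , (j , j∈B)
    ... | inj₂ i∈B | inj₁ j∈A = (j , j∈A) , (i , i∈B)
    ... | inj₂ i∈B | inj₂ j∈B = contradiction i∼j (indB i∈B j∈B)

  -- Bounds on the dual Cheeger constant.

  module _ (2≤n : 2 ℕ.≤ n) (conn : Connected Γ) where

    cheegerRatio≤1 : ∀ P → cheegerRatio Γ 2≤n conn P ≤ 1#
    cheegerRatio≤1 P = /-≤1 (vol₁+vol₂-pos Γ 2≤n conn P)
      (vol+vol≈2E+deficit (V₁ P) (V₂ P)) (deficit-nonneg (V₁ P) (V₂ P))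

    dualCheeger≤1 : dualCheeger Γ 2≤n conn ≤ 1#
    dualCheeger≤1 = dualCheeger-least Γ 2≤n conn 1# cheegerRatio≤1

    1≤cheegerRatio⇒bipartite : ∀ P → 1# ≤ cheegerRatio Γ 2≤n conn P →
                               Bipartite Γ
    1≤cheegerRatio⇒bipartite P 1≤ratio = deficit≈0⇒bipartite conn P
      (/-≈1⇒≈0 (vol₁+vol₂-pos Γ 2≤n conn P) (vol+vol≈2E+deficit (V₁ P) (V₂ P))
        (≤-antisym (cheegerRatio≤1 P) 1≤ratio))

    1≤dualCheeger⇒bipartite : 1# ≤ dualCheeger Γ 2≤n conn → Bipartite Γ
    1≤dualCheeger⇒bipartite 1≤h = decidable-stable Bipartite? λ ¬bip →
      foldr-⊔-¬≤ (cheegerRatio Γ 2≤n conn)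
        -- The seed of the fold is itself a ratio and is refuted like the others.
        (¬bip ∘ 1≤cheegerRatio⇒bipartite (somePartition 2≤n))
        (λ P → ¬bip ∘ 1≤cheegerRatio⇒bipartite P) (partitions n) 1≤h

    someEdge : ∃[ i ] ∃[ j ] i ∼ j
    someEdge with nonempty₁ (somePartition 2≤n)
    ... | i , _ = i , neighbour Γ 2≤n conn i

    bipartite⇒1≤dualCheeger : Bipartite Γ → 1# ≤ dualCheeger Γ 2≤n conn
    bipartite⇒1≤dualCheeger bip with bipartite⇒partition someEdge bip
    ... | P , d≈0 = ≤-trans
      (≈⇒≤ (sym (≈0⇒/-≈1 (vol₁+vol₂-pos Γ 2≤n conn P)
                         (vol+vol≈2E+deficit (V₁ P) (V₂ P)) d≈0)))
      (dualCheeger-upper Γ 2≤n conn P)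

theorem3p1 : ∀ {c ℓ₁ ℓ₂ : Level} (ℝ : Reals c ℓ₁ ℓ₂) {n : ℕ}
    (2≤n : 2 ℕ.≤ n) (Γ : WeightedGraph ℝ n) (conn : Connected Γ) →
    let open Reals ℝ in
    (dualCheeger Γ 2≤n conn ≤ 1#)
    × (dualCheeger Γ 2≤n conn ≈ 1# ⇔ Bipartite Γ)
theorem3p1 ℝ 2≤n Γ conn =
  dualCheeger≤1 2≤n conn ,
  -- Given the upper bound, equality with 1 amounts to `1# ≤ dualCheeger`.
  mk⇔ (λ h≈1 → 1≤dualCheeger⇒bipartite 2≤n conn (≈⇒≤ (sym h≈1)))
      (λ bip → ≤-antisym (dualCheeger≤1 2≤n conn)
                         (bipartite⇒1≤dualCheeger 2≤n conn bip))
  where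
  open Reals ℝ
  open RealProperties ℝ
  open GraphProperties ℝ Γ
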